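{- Let $D_3,D_4,D_5$ be the edge-ordered graphs on the four vertices $a,b,v,w$ with exactly the five edges $ab,av,aw,bv,bw$, with edge orders \[D_3:\ l(ab)<l(av)<l(aw)<l(bv)<l(bw),\] \[D_4:\ l(ab)<l(av)<l(bv)<l(aw)<l(bw),\] \[D_5:\ l(ab)<l(av)<l(bv)<l(bw)<l(aw).\] Then $sat_m(n,D_i)=\Theta(n)$ for each $i\in\{3,4,5\}$.
   Context: An edge-ordered graph is a finite simple graph together with a linear order on its edge set given by an injective labeling $l$ to $\mathbb{N}$ or $\mathbb{R}$. An edge-ordered graph $H$ contains $G$ (has a copy of $G$) if $G$ is isomorphic, by an isomorphism respecting the edge-order, to a subgraph of $H$ with the induced order; otherwise $H$ is $G$-free. $sat_m(n,G)$ is the minimum number of edges in a $G$-free edge-ordered graph $H$ on $n$ vertices such that adding to $H$ any missing edge, inserted at the beginning of the linear order (i.e. with a label smaller than all labels of $H$), creates a copy of $G$. Asymptotic notation is for $n\to\infty$. -}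

module Defs where

open import Data.Fin using (Fin; zero; suc; toℕ; _<_)
open import Data.Fin.Properties using (_≟_; _<?_)
open import Data.List using (List; []; _∷_; length)
open import Data.List.Membership.Propositional using (_∈_; _∉_)
open import Data.List.Relation.Unary.All using (All; []; _∷_; all?)
open import Data.List.Relation.Unary.All.Properties using (¬Any⇒All¬)
open import Data.List.Relation.Unary.AllPairs using (_∷_)
open import Data.List.Relation.Unary.Any using (index)
open import Data.List.Relation.Unary.Unique.Propositional using (Unique)
import Data.List.Relation.Unary.Unique.DecPropositional as DecUnique
open import Data.Nat as ℕ using (ℕ; _≤_; _≥_; _*_)
open import Data.Product using (_×_; _,_; proj₁; proj₂; Σ-syntax; uncurry)
open import Data.Product.Properties using (≡-dec)
open import Data.Sum using (_⊎_; [_,_]′)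
open import Function.Definitions using (Injective)
open import Relation.Binary.PropositionalEquality using (_≡_)
open import Relation.Nullary using (¬_)
open import Relation.Nullary.Decidable using (True; toWitness)

-- An edge-ordered graph on the vertex set Fin n.  The undirected edge {u , v}
-- is stored once, as the pair (u , v) with u < v, and the edges are listed in
-- increasing edge order, so that the label of an edge is its position.
-- Up to order-preserving relabelling every injective labelling of the edges of
-- a finite graph is of this form.
record EdgeOrderedGraph (n : ℕ) : Set where
  constructor mkGraph
  field
    edges    : List (Fin n × Fin n)
    oriented : All (uncurry _<_) edges
    unique   : Unique edges

open EdgeOrderedGraph public

private
  variable
    k n : ℕ

Adj : EdgeOrderedGraph n → Fin n → Fin n → Set
Adj H u v = (u , v) ∈ edges H ⊎ (v , u) ∈ edges H

-- Does not depend on the adjacency proof, as edges are listed only once.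
label : (H : EdgeOrderedGraph n) {u v : Fin n} → Adj H u v → ℕ
label H = [ (λ e → toℕ (index e)) , (λ e → toℕ (index e)) ]′

numEdges : EdgeOrderedGraph n → ℕ
numEdges H = length (edges H)

-- The subgraph of H formed by the images of the edges of G need not be
-- induced.  As labels are injective, preserving the strict order of the labels
-- also reflects it.
record Copy (G : EdgeOrderedGraph k) (H : EdgeOrderedGraph n) : Set where
  field
    vertex    : Fin k → Fin n
    injective : Injective _≡_ _≡_ vertex
    edge      : ∀ {u v} → Adj G u v → Adj H (vertex u) (vertex v)
    monotone  : ∀ {u v x y} (e : Adj G u v) (f : Adj G x y) →
                label G e ℕ.< label G f → label H (edge e) ℕ.< label H (edge f)

_Free : EdgeOrderedGraph k → EdgeOrderedGraph n → Set
(G Free) H = ¬ Copy G H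

addFirst : (H : EdgeOrderedGraph n) (u v : Fin n) →
           u < v → (u , v) ∉ edges H → EdgeOrderedGraph n
addFirst H u v u<v uv∉H = record
  { edges    = (u , v) ∷ edges H
  ; oriented = u<v ∷ oriented H
  ; unique   = ¬Any⇒All¬ (edges H) uv∉H ∷ unique H
  }

record Saturatedₘ (G : EdgeOrderedGraph k) (H : EdgeOrderedGraph n) : Set where
  field
    free     : (G Free) H
    saturate : ∀ u v (u<v : u < v) (uv∉H : (u , v) ∉ edges H) →
               Copy G (addFirst H u v u<v uv∉H)

-- IsSatₘ n G s means sat_m(n, G) = s.
record IsSatₘ (n : ℕ) (G : EdgeOrderedGraph k) (s : ℕ) : Set where
  field
    attained : Σ[ H ∈ EdgeOrderedGraph n ] Saturatedₘ G H × numEdges H ≡ s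
    minimal  : (H : EdgeOrderedGraph n) → Saturatedₘ G H → s ≤ numEdges H

-- The lower bound f n ≥ (1/c) g n is written without fractions.
_=Θ_ : (ℕ → ℕ) → (ℕ → ℕ) → Set
f =Θ g = Σ[ c ∈ ℕ ] Σ[ C ∈ ℕ ] Σ[ N ∈ ℕ ] 0 ℕ.< c × 0 ℕ.< C ×
         (∀ n → n ≥ N → g n ≤ c * f n × f n ≤ C * g n)

private
  fromList : (es : List (Fin n × Fin n)) →
             {True (all? (λ e → proj₁ e <? proj₂ e) es)} →
             {True (DecUnique.unique? (≡-dec _≟_ _≟_) es)} →
             EdgeOrderedGraph n
  fromList es {o} {u} = mkGraph es (toWitness o) (toWitness u)

  a b v w : Fin 4
  a = zero
  b = suc zero
  v = suc (suc zero)
  w = suc (suc (suc zero))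

D₃ D₄ D₅ : EdgeOrderedGraph 4
D₃ = fromList ((a , b) ∷ (a , v) ∷ (a , w) ∷ (b , v) ∷ (b , w) ∷ [])
D₄ = fromList ((a , b) ∷ (a , v) ∷ (b , v) ∷ (a , w) ∷ (b , w) ∷ [])
D₅ = fromList ((a , b) ∷ (a , v) ∷ (b , v) ∷ (b , w) ∷ (a , w) ∷ [])

module Submission where

-- Lower bound: H is D-free, so a new first edge xy that creates a copy of D is
-- the first edge ab of that copy, and both x and y already lie on edges of H.
-- Thus no vertex of H is isolated.
-- Upper bound: join two hubs p, q to all other vertices and to each other, the edge
-- between the hubs being last.  Every triangle contains the hub edge, so it
-- would be the diagonal ab of any copy of D, yet it is not first.  A missing
-- edge joins two leaves xᵢ and xⱼ with i < j, and completes D as soon as the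
-- spokes at p and q are ordered as x₁p x₁q x₂p x₂q … for D₃,
-- x₁p x₂p … x₁q x₂q … for D₄, and x₁p x₂p … xₘp xₘq … x₂q x₁q for D₅.
-- Both freeness and saturation are decidable, which yields the minimum.

open import Data.Fin using (Fin; zero; suc; toℕ; _<_)
open import Data.Fin.Patterns using (0F; 1F; 2F; 3F)
open import Data.Fin.Properties using (_≟_; _<?_; any?; all?; <-cmp; suc-injective; injective⇒≤)
open import Data.List using (List; []; _∷_; _++_; map; reverse; length; tabulate; allFin)
open import Data.List.Properties using (length-++; length-map; length-tabulate)
open import Data.List.Membership.Propositional using (_∈_; _∉_)
open import Data.List.Membership.Propositional.Properties
  using (∈-map⁺; ∈-map⁻; ∈-++⁺ˡ; ∈-++⁺ʳ; ∈-allFin; ∈-tabulate⁺)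
open import Data.List.Relation.Binary.Permutation.Propositional
  using (_↭_; ↭-refl; ↭-trans; ↭-sym; prep; ↭⇒↭ₛ)
import Data.List.Relation.Binary.Permutation.Propositional.Properties as Perm
import Data.List.Relation.Binary.Permutation.Setoid.Properties as PermSetoid
open import Data.List.Relation.Binary.Sublist.Heterogeneous using (Sublist; []; _∷_; _∷ʳ_; minimum)
import Data.List.Relation.Binary.Sublist.Heterogeneous.Properties as Sublist
open import Data.List.Relation.Binary.Sublist.Propositional using (_⊆_; from∈)
import Data.List.Relation.Binary.Sublist.Propositional.Properties as ⊆
open import Data.List.Relation.Unary.All as All using (All; []; _∷_)
import Data.List.Relation.Unary.All.Properties as All
open import Data.List.Relation.Unary.Any as Any using (Any; here; there; index)
open import Data.List.Relation.Unary.Any.Properties using (lookup-index; Any-⊎⁻; ++⁻)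
open import Data.List.Relation.Unary.Unique.Propositional using (Unique; []; _∷_)
import Data.List.Relation.Unary.Unique.Propositional.Properties as Unique
import Data.List.Relation.Unary.Unique.DecPropositional as DecUnique
import Data.List.Membership.DecPropositional as DecMembership
open import Data.Nat as ℕ using (ℕ; zero; suc; _+_; _*_; _≤_; z≤n; s≤s)
import Data.Nat.Properties as ℕ
open import Data.Nat.Solver using (module +-*-Solver)
open import Data.Product using (_×_; _,_; proj₁; proj₂; Σ-syntax; ∃; uncurry)
open import Data.Product.Properties using (≡-dec)
open import Data.Sum using (_⊎_; inj₁; inj₂; [_,_]′)
open import Data.Vec as Vec using (Vec; []; _∷_; lookup)
open import Data.Vec.Properties using (lookup∘tabulate; length-toList; toList∘fromList)
open import Function using (_∘_; id)
open import Function.Definitions using (Injective)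
open import Relation.Binary using (tri<; tri≈; tri>)
open import Relation.Binary.PropositionalEquality
  using (_≡_; _≢_; refl; sym; trans; cong; cong₂; subst; subst₂; setoid)
open import Relation.Nullary using (¬_; Dec; yes; no; contradiction)
open import Relation.Nullary.Decidable using (map′; _×-dec_; _⊎-dec_; _→-dec_; ¬?)
open import Relation.Unary using (Decidable)
open import Defs

private
  variable
    A B : Set
    R : A → B → Set
    k n : ℕ

-- Sublists and positions

position : {P : A → Set} {xs : List A} → Any P xs → ℕ
position p = toℕ (index p)

locate : ∀ {xs ys} {x : A} → Sublist R xs ys → x ∈ xs → Any (R x) ys
locate (_ ∷ʳ τ) i           = there (locate τ i)
locate (r ∷ τ)  (here refl) = here r
locate (_ ∷ τ)  (there i)   = there (locate τ i)

locate-mono : ∀ {xs ys} {x y : A} (τ : Sublist R xs ys) (i : x ∈ xs) (j : y ∈ xs) →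
              position i ℕ.< position j → position (locate τ i) ℕ.< position (locate τ j)
locate-mono (_ ∷ʳ τ) i           j         i<j       = s≤s (locate-mono τ i j i<j)
locate-mono (_ ∷ τ)  (here refl) (there j) _         = s≤s z≤n
locate-mono (_ ∷ τ)  (there i)   (there j) (s≤s i<j) = s≤s (locate-mono τ i j i<j)

unthere : ∀ {P : A → Set} {x xs} (p : Any P (x ∷ xs)) → 0 ℕ.< position p →
          Σ[ q ∈ Any P xs ] position p ≡ suc (position q)
unthere (there p) _ = p , refl

-- Induction on `ys`. If the head goes to the first entry, the two are matched; otherwise that entry
-- is skipped. Either way monotonicity puts the remaining images past it, so `φ` restricts to the
-- tail.
fromMonotone : ∀ (xs : List A) (ys : List B) (φ : ∀ {x} → x ∈ xs → Any (R x) ys) →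
               (∀ {x y} (i : x ∈ xs) (j : y ∈ xs) →
                position i ℕ.< position j → position (φ i) ℕ.< position (φ j)) →
               Sublist R xs ys
fromMonotone []       ys       φ mono = minimum ys
fromMonotone (x ∷ xs) []       φ mono with () ← φ (here refl)
fromMonotone {R = R} (x ∷ xs) (y ∷ ys) φ mono with φ (here refl) in eq
... | here r = r ∷ fromMonotone xs ys (λ i → proj₁ (ψ i)) λ i j i<j →
        ℕ.≤-pred (subst₂ ℕ._<_ (proj₂ (ψ i)) (proj₂ (ψ j)) (mono (there i) (there j) (s≤s i<j)))
  where
  ψ : ∀ {z} (i : z ∈ xs) → Σ[ q ∈ Any (R z) ys ] position (φ (there i)) ≡ suc (position q)
  ψ i = unthere (φ (there i)) (ℕ.≤-<-trans z≤n (mono (here refl) (there i) (s≤s z≤n)))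
... | there p = y ∷ʳ fromMonotone (x ∷ xs) ys (λ i → proj₁ (ψ i)) λ i j i<j →
        ℕ.≤-pred (subst₂ ℕ._<_ (proj₂ (ψ i)) (proj₂ (ψ j)) (mono i j i<j))
  where
  positive : ∀ {z} (i : z ∈ x ∷ xs) → 0 ℕ.< position (φ i)
  positive (here refl) = subst (λ q → 0 ℕ.< position q) (sym eq) (s≤s z≤n)
  positive (there i)   = ℕ.≤-<-trans z≤n (mono (here refl) (there i) (s≤s z≤n))
  ψ : ∀ {z} (i : z ∈ x ∷ xs) → Σ[ q ∈ Any (R z) ys ] position (φ i) ≡ suc (position q)
  ψ i = unthere (φ i) (positive i)

-- The entry `y` must be matched after `x`, which leaves `x` no room at the final place. This keeps
-- a hub edge placed last from being the first edge of a copy.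
head-before-last : ∀ {x y : A} {xs} zs {z} → Sublist R (x ∷ xs) (zs ++ z ∷ []) → y ∈ xs → Any (R x) zs
head-before-last []       (r ∷ []) ()
head-before-last (_ ∷ zs) (r ∷ _)  _ = here r
head-before-last (_ ∷ zs) (_ ∷ʳ τ) i = there (head-before-last zs τ i)

pair⊆tabulate : (f : Fin n → A) {i j : Fin n} → i < j → f i ∷ f j ∷ [] ⊆ tabulate f
pair⊆tabulate f {zero}  {suc j} _         = refl ∷ from∈ (∈-tabulate⁺ j)
pair⊆tabulate f {suc i} {suc j} (s≤s i<j) = _ ∷ʳ pair⊆tabulate (f ∘ suc) i<j

-- Choosing for each vertex a position where it occurs is injective, as looking up that position
-- returns the vertex.
length-cover : {xs : List (Fin n)} → (∀ x → x ∈ xs) → n ≤ length xs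
length-cover {xs = xs} cover = injective⇒≤ {f = λ x → index (cover x)} λ {x} {y} eq →
  trans (lookup-index (cover x))
        (trans (cong (Data.List.lookup xs) eq) (sym (lookup-index (cover y))))

-- Finite search

-- Omniscience, a property of finite types. It passes to pairs and vectors, so vertex maps and edge
-- lists can be searched exhaustively.
Searchable : Set → Set₁
Searchable A = ∀ {P : A → Set} → Decidable P → Dec (∃ P)

searchPair : Searchable A → Searchable B → Searchable (A × B)
searchPair anyA anyB P? = map′ (λ (a , b , p) → (a , b) , p) (λ ((a , b) , p) → a , b , p)
                               (anyA λ a → anyB λ b → P? (a , b))

searchVec : Searchable A → ∀ k → Searchable (Vec A k)
searchVec anyA zero    P? = map′ ([] ,_) (λ { ([] , p) → p }) (P? [])
searchVec anyA (suc k) P? = map′ (λ (x , xs , p) → x ∷ xs , p) (λ { (x ∷ xs , p) → x , xs , p })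
                                 (anyA λ x → searchVec anyA k λ xs → P? (x ∷ xs))

Least : (ℕ → Set) → ℕ → Set
Least P m = P m × (∀ k → P k → m ≤ k)

least : {P : ℕ → Set} → Decidable P → ∃ P → ∃ (Least P)
least {P} P? (n , p) = go P? n p
  where
  -- The recursive call searches the shifted predicate `P ∘ suc`, so `go` quantifies over `P`
  -- itself.
  go : {P : ℕ → Set} → Decidable P → ∀ n → P n → ∃ (Least P)
  go P? n p with P? 0
  go P? n       p | yes p₀ = 0 , p₀ , λ _ _ → z≤n
  go P? zero    p | no ¬p₀ = contradiction p ¬p₀
  go {P} P? (suc n) p | no ¬p₀ with m , pm , min ← go (P? ∘ suc) n p =
    suc m , pm , λ { zero p₀ → contradiction p₀ ¬p₀ ; (suc k) pk → s≤s (min k pk) }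

-- Copies as sublists

Edges : ℕ → Set
Edges n = List (Fin n × Fin n)

_≟ᵉ_ : (e f : Fin n × Fin n) → Dec (e ≡ f)
_≟ᵉ_ = ≡-dec _≟_ _≟_

open module Member {n} = DecMembership (_≟ᵉ_ {n}) using (_∈?_)

-- Edges are stored with the smaller end first, which a vertex map may reverse; hence both
-- orientations.
Joins : Vec (Fin n) k → Fin k × Fin k → Fin n × Fin n → Set
Joins xs (u , v) e = (lookup xs u , lookup xs v) ≡ e ⊎ (lookup xs v , lookup xs u) ≡ e

-- A copy in decidable form: the vertex map is a vector, and the edge map with its monotonicity is a
-- single sublist.
Embeds : Edges k → Edges n → Set
Embeds {k} {n} ps es = Σ[ xs ∈ Vec (Fin n) k ] Injective _≡_ _≡_ (lookup xs) × Sublist (Joins xs) ps es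

embeds? : (ps : Edges k) (es : Edges n) → Dec (Embeds ps es)
embeds? {k} ps es = searchVec any? k λ xs →
  map′ (λ inj {u} {v} → inj u v) (λ inj u v → inj {u} {v})
       (all? λ u → all? λ v → (lookup xs u ≟ lookup xs v) →-dec (u ≟ v))
  ×-dec Sublist.sublist? (λ _ e → (_ ≟ᵉ e) ⊎-dec (_ ≟ᵉ e)) ps es

position-map : {P Q : A → Set} {xs : List A} (f : ∀ {x} → P x → Q x) (p : Any P xs) →
               position (Any.map f p) ≡ position p
position-map f (here _)  = refl
position-map f (there p) = cong suc (position-map f p)

position-⊎⁻ : {P Q : A → Set} {xs : List A} (p : Any (λ x → P x ⊎ Q x) xs) →
              [ position , position ]′ (Any-⊎⁻ p) ≡ position p
position-⊎⁻ (here (inj₁ _)) = refl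
position-⊎⁻ (here (inj₂ _)) = refl
position-⊎⁻ (there p) with Any-⊎⁻ p | position-⊎⁻ p
... | inj₁ _ | eq = cong suc eq
... | inj₂ _ | eq = cong suc eq

-- An adjacency in either direction comes from a listed edge, which `locate` carries to `H`;
-- flipping the direction keeps the position.
embeds⇒copy : {G : EdgeOrderedGraph k} {H : EdgeOrderedGraph n} →
              Embeds (edges G) (edges H) → Copy G H
embeds⇒copy {G = G} {H} (xs , inj , τ) = record
  { vertex    = lookup xs
  ; injective = inj
  ; edge      = λ e → Any-⊎⁻ (image e)
  ; monotone  = λ e f e<f → subst₂ ℕ._<_ (sym (position-⊎⁻ (image e))) (sym (position-⊎⁻ (image f)))
                                         (image-mono e f e<f)
  }
  where
  flipJoins : ∀ {u v e} → Joins xs (v , u) e → Joins xs (u , v) e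
  flipJoins = [ inj₂ , inj₁ ]′

  image : ∀ {u v} → Adj G u v → Any (Joins xs (u , v)) (edges H)
  image (inj₁ i) = locate τ i
  image (inj₂ i) = Any.map flipJoins (locate τ i)

  source : ∀ {u v} (e : Adj G u v) → ∃ λ x → x ∈ edges G
  source (inj₁ i) = _ , i
  source (inj₂ i) = _ , i

  label-source : ∀ {u v} (e : Adj G u v) → label G e ≡ position (proj₂ (source e))
  label-source (inj₁ i) = refl
  label-source (inj₂ i) = refl

  position-image : ∀ {u v} (e : Adj G u v) →
                   position (image e) ≡ position (locate τ (proj₂ (source e)))
  position-image (inj₁ i) = refl
  position-image (inj₂ i) = position-map flipJoins (locate τ i)

  image-mono : ∀ {u v x y} (e : Adj G u v) (f : Adj G x y) → label G e ℕ.< label G f →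
               position (image e) ℕ.< position (image f)
  image-mono e f e<f = subst₂ ℕ._<_ (sym (position-image e)) (sym (position-image f))
    (locate-mono τ (proj₂ (source e)) (proj₂ (source f))
      (subst₂ ℕ._<_ (label-source e) (label-source f) e<f))

-- The listed edges of `G`, taken in their stored direction, have images in increasing positions, so
-- `fromMonotone` yields the sublist.
copy⇒embeds : {G : EdgeOrderedGraph k} {H : EdgeOrderedGraph n} →
              Copy G H → Embeds (edges G) (edges H)
copy⇒embeds {G = G} {H} C = xs , inj ,
  fromMonotone (edges G) (edges H) (λ i → image (edge (inj₁ i))) λ i j i<j →
    subst₂ ℕ._<_ (sym (position-image (edge (inj₁ i)))) (sym (position-image (edge (inj₁ j))))
      (monotone (inj₁ i) (inj₁ j) i<j)
  where
  open Copy C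
  xs = Vec.tabulate vertex

  inj : Injective _≡_ _≡_ (lookup xs)
  inj {u} {v} eq =
    injective (trans (sym (lookup∘tabulate vertex u)) (trans eq (lookup∘tabulate vertex v)))

  tabulated : ∀ u v → (lookup xs u , lookup xs v) ≡ (vertex u , vertex v)
  tabulated u v = cong₂ _,_ (lookup∘tabulate vertex u) (lookup∘tabulate vertex v)

  image : ∀ {u v} → Adj H (vertex u) (vertex v) → Any (Joins xs (u , v)) (edges H)
  image {u} {v} (inj₁ i) = Any.map (λ eq → inj₁ (trans (tabulated u v) eq)) i
  image {u} {v} (inj₂ i) = Any.map (λ eq → inj₂ (trans (tabulated v u) eq)) i

  position-image : ∀ {u v} (e : Adj H (vertex u) (vertex v)) → position (image {u} {v} e) ≡ label H e
  position-image (inj₁ i) = position-map _ i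
  position-image (inj₂ i) = position-map _ i

-- Existence of the saturation number

-- Stated for bare edge lists, so that finite search decides it.
record SaturatedEdges (ps : Edges k) (es : Edges n) : Set where
  constructor saturatedEdges
  field
    free     : ¬ Embeds ps es
    saturate : ∀ u v → u < v → (u , v) ∉ es → Embeds ps ((u , v) ∷ es)

saturatedEdges? : (ps : Edges k) (es : Edges n) → Dec (SaturatedEdges ps es)
saturatedEdges? ps es =
  map′ (uncurry saturatedEdges) (λ (saturatedEdges f s) → f , s)
    (¬? (embeds? ps es) ×-dec
     all? λ u → all? λ v → (u <? v) →-dec (¬? ((u , v) ∈? es)) →-dec embeds? ps ((u , v) ∷ es))

module _ {G : EdgeOrderedGraph k} {H : EdgeOrderedGraph n} where

  saturated⇒edges : Saturatedₘ G H → SaturatedEdges (edges G) (edges H)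
  saturated⇒edges S = saturatedEdges (free ∘ embeds⇒copy)
    λ u v u<v uv∉H → copy⇒embeds (saturate u v u<v uv∉H)
    where open Saturatedₘ S

  edges⇒saturated : SaturatedEdges (edges G) (edges H) → Saturatedₘ G H
  edges⇒saturated (saturatedEdges free saturate) = record
    { free     = free ∘ copy⇒embeds
    ; saturate = λ u v u<v uv∉H → embeds⇒copy (saturate u v u<v uv∉H)
    }

HasSaturated : EdgeOrderedGraph k → ℕ → ℕ → Set
HasSaturated G n s = Σ[ H ∈ EdgeOrderedGraph n ] Saturatedₘ G H × numEdges H ≡ s

-- Once the number of edges is fixed to `s`, edge lists are vectors of length `s` over a finite
-- type, and each condition on them is decidable.
hasSaturated? : (G : EdgeOrderedGraph k) (n : ℕ) → Decidable (HasSaturated G n)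
hasSaturated? G n s =
  map′ (λ (es , o , u , S) → mkGraph (Vec.toList es) o u , edges⇒saturated S , length-toList es)
       (λ { (H , S , refl) → Vec.fromList (edges H) ,
            subst (λ es → All (uncurry _<_) es × Unique es × SaturatedEdges (edges G) es)
                  (sym (toList∘fromList (edges H)))
                  (oriented H , unique H , saturated⇒edges S) })
       (searchVec (searchPair any? any?) s λ es →
         All.all? (uncurry _<?_) (Vec.toList es) ×-dec
         DecUnique.unique? _≟ᵉ_ (Vec.toList es) ×-dec
         saturatedEdges? (edges G) (Vec.toList es))

isSat : {G : EdgeOrderedGraph k} → ∃ (HasSaturated G n) → ∃ (IsSatₘ n G)
isSat {n = n} {G} ex with s , attained , min ← least (hasSaturated? G n) ex =
  s , record { attained = attained ; minimal = λ H S → min (numEdges H) (H , S , refl) }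

-- Diamonds

-- The indices 0, 1, 2, 3 stand for a, b, v, w. Recording membership alone lets one argument for the
-- lower bound and for freeness serve all three orders.
record Rim (rim : Edges 4) : Set where
  constructor isRim
  field
    av : (0F , 2F) ∈ rim
    aw : (0F , 3F) ∈ rim
    bv : (1F , 2F) ∈ rim
    bw : (1F , 3F) ∈ rim

endpoints : Edges n → List (Fin n)
endpoints es = map proj₁ es ++ map proj₂ es

length-endpoints : (es : Edges n) → length (endpoints es) ≡ 2 * length es
length-endpoints es = trans (length-++ (map proj₁ es))
  (cong₂ _+_ (length-map proj₁ es) (trans (length-map proj₂ es) (sym (ℕ.+-identityʳ _))))

joins⇒endpointˡ : {xs : Vec (Fin n) k} {es : Edges n} {u v : Fin k} →
                  Any (Joins xs (u , v)) es → lookup xs u ∈ endpoints es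
joins⇒endpointˡ {es = es} = [ ∈-++⁺ˡ ∘ ∈-map⁺ proj₁ , ∈-++⁺ʳ (map proj₁ es) ∘ ∈-map⁺ proj₂ ]′ ∘ Any-⊎⁻

distinct : (x : Fin (2 + n)) → ∃ λ y → x ≢ y
distinct zero    = 1F , λ ()
distinct (suc x) = 0F , λ ()

module _ {rim : Edges 4} (sides : Rim rim) where

  open Rim sides

  private
    diamond : Edges 4
    diamond = (0F , 1F) ∷ rim

  -- The added edge is the only candidate for the first edge of the diamond
  -- it creates, and both ends of that edge lie on further edges.
  endpoints-covered : {es : Edges (2 + n)} → SaturatedEdges diamond es → ∀ x → x ∈ endpoints es
  endpoints-covered {n} {es} (saturatedEdges free saturate) x = case-distinct (distinct x)
    where
    new-edge : ∀ {e} → Embeds diamond (e ∷ es) →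
               proj₁ e ∈ endpoints es × proj₂ e ∈ endpoints es
    new-edge (xs , inj , _ ∷ʳ τ) = contradiction (xs , (λ {_} {_} → inj) , τ) free
    new-edge (xs , _ , r ∷ τ) =
      ends r (joins⇒endpointˡ {xs = xs} (locate τ av)) (joins⇒endpointˡ {xs = xs} (locate τ bv))
      where
      ends : ∀ {e} → Joins xs (0F , 1F) e → lookup xs 0F ∈ endpoints es → lookup xs 1F ∈ endpoints es →
             proj₁ e ∈ endpoints es × proj₂ e ∈ endpoints es
      ends (inj₁ refl) a b = a , b
      ends (inj₂ refl) a b = b , a

    covered : ∀ u v → u < v → u ∈ endpoints es × v ∈ endpoints es
    covered u v u<v with (u , v) ∈? es
    ... | yes uv∈es = ∈-++⁺ˡ (∈-map⁺ proj₁ uv∈es) , ∈-++⁺ʳ (map proj₁ es) (∈-map⁺ proj₂ uv∈es)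
    ... | no  uv∉es = new-edge (saturate u v u<v uv∉es)

    case-distinct : (∃ λ y → x ≢ y) → x ∈ endpoints es
    case-distinct (y , x≢y) with <-cmp x y
    ... | tri< x<y _ _ = proj₁ (covered x y x<y)
    ... | tri≈ _ x≡y _ = contradiction x≡y x≢y
    ... | tri> _ _ y<x = proj₂ (covered y x y<x)

  -- The endpoint list covers all vertices and has two entries per edge.
  order≤2*size : {es : Edges (2 + n)} → SaturatedEdges diamond es → 2 + n ≤ 2 * length es
  order≤2*size {es = es} S =
    subst (_ ≤_) (length-endpoints es) (length-cover (endpoints-covered S))

-- Complete bipartite graphs with two hubs

data Hub {n} : Fin (2 + n) → Set where
  hub₀ : Hub 0F
  hub₁ : Hub 1F

no-three-hubs : {xs : Vec (Fin (2 + n)) k} → Injective _≡_ _≡_ (lookup xs) → ∀ {x y z} →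
                x ≢ y → x ≢ z → y ≢ z →
                Hub (lookup xs x) → Hub (lookup xs y) → ¬ Hub (lookup xs z)
no-three-hubs {xs = xs} inj {x} {y} {z} x≢y x≢z y≢z = go refl refl refl
  where
  -- The images become variables tied by equations, so that the `Hub` proofs can be matched on.
  go : ∀ {i j k} → lookup xs x ≡ i → lookup xs y ≡ j → lookup xs z ≡ k → Hub i → Hub j → ¬ Hub k
  go x≡ y≡ z≡ hub₀ hub₀ _ = x≢y (inj (trans x≡ (sym y≡)))
  go x≡ y≡ z≡ hub₁ hub₁ _ = x≢y (inj (trans x≡ (sym y≡)))
  go x≡ y≡ z≡ hub₀ hub₁ hub₀ = x≢z (inj (trans x≡ (sym z≡)))
  go x≡ y≡ z≡ hub₀ hub₁ hub₁ = y≢z (inj (trans y≡ (sym z≡)))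
  go x≡ y≡ z≡ hub₁ hub₀ hub₀ = y≢z (inj (trans y≡ (sym z≡)))
  go x≡ y≡ z≡ hub₁ hub₀ hub₁ = x≢z (inj (trans x≡ (sym z≡)))

-- The hubs are the two smallest vertices, so each spoke is stored hub first.
spoke : Fin 2 → Fin n → Fin (2 + n) × Fin (2 + n)
spoke 0F i = 0F , suc (suc i)
spoke 1F i = 1F , suc (suc i)

spoke-injective : ∀ h {i j : Fin n} → spoke h i ≡ spoke h j → i ≡ j
spoke-injective 0F refl = refl
spoke-injective 1F refl = refl

spokes : ∀ n → Edges (2 + n)
spokes n = map (spoke 0F) (allFin n) ++ map (spoke 1F) (allFin n)

spokes-unique : ∀ n → Unique (spokes n)
spokes-unique n = Unique.++⁺ (Unique.map⁺ (spoke-injective 0F) (Unique.allFin⁺ n))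
                             (Unique.map⁺ (spoke-injective 1F) (Unique.allFin⁺ n))
                             λ (i , j) → disjoint (∈-map⁻ (spoke 0F) i) (∈-map⁻ (spoke 1F) j)
  where
  disjoint : ∀ {e} → (∃ λ i → i ∈ allFin n × e ≡ spoke 0F i) →
             ¬ (∃ λ j → j ∈ allFin n × e ≡ spoke 1F j)
  disjoint (_ , _ , refl) (_ , _ , ())

all-spokes : ∀ n {P : Fin (2 + n) × Fin (2 + n) → Set} →
             (∀ h i → P (spoke h i)) → All P (spokes n)
all-spokes n f = All.++⁺ (All.map⁺ (All.universal (f 0F) (allFin n)))
                         (All.map⁺ (All.universal (f 1F) (allFin n)))

∈-spokes : ∀ h (i : Fin n) → spoke h i ∈ spokes n
∈-spokes         0F i = ∈-++⁺ˡ (∈-map⁺ (spoke 0F) (∈-allFin i))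
∈-spokes {n = n} 1F i = ∈-++⁺ʳ (map (spoke 0F) (allFin n)) (∈-map⁺ (spoke 1F) (∈-allFin i))

length-spokes : ∀ n → length (spokes n) ≡ n + n
length-spokes n = trans (length-++ (map (spoke 0F) (allFin n))) (cong₂ _+_ (half 0F) (half 1F))
  where
  half : ∀ h → length (map (spoke h) (allFin n)) ≡ n
  half h = trans (length-map (spoke h) (allFin n)) (length-tabulate id)

-- The vertices a, b, v, w of the diamond are sent to 2 + i, 2 + j, 0, 1.
leafPair : Fin n → Fin n → Vec (Fin (2 + n)) 4
leafPair i j = suc (suc i) ∷ suc (suc j) ∷ 0F ∷ 1F ∷ []

leafPair-injective : {i j : Fin n} → i ≢ j → Injective _≡_ _≡_ (lookup (leafPair i j))
leafPair-injective i≢j {0F} {0F} eq = refl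
leafPair-injective i≢j {0F} {1F} eq = contradiction (suc-injective (suc-injective eq)) i≢j
leafPair-injective i≢j {1F} {0F} eq = contradiction (suc-injective (suc-injective (sym eq))) i≢j
leafPair-injective i≢j {1F} {1F} eq = refl
leafPair-injective i≢j {2F} {2F} eq = refl
leafPair-injective i≢j {3F} {3F} eq = refl
leafPair-injective i≢j {0F} {2F} ()
leafPair-injective i≢j {0F} {3F} ()
leafPair-injective i≢j {1F} {2F} ()
leafPair-injective i≢j {1F} {3F} ()
leafPair-injective i≢j {2F} {3F} ()

-- The only data specific to one of the three graphs: an arrangement of the spokes that shows the
-- rim in its order at any two leaves.
record SpokeOrder (rim : Edges 4) (n : ℕ) : Set where
  field
    order  : Edges (2 + n)
    order↭ : order ↭ spokes n
    leaves : {i j : Fin n} → i < j → Sublist (Joins (leafPair i j)) rim order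

module Book {rim : Edges 4} (sides : Rim rim) (O : SpokeOrder rim n) where

  open Rim sides
  open SpokeOrder O

  private
    diamond : Edges 4
    diamond = (0F , 1F) ∷ rim

  -- The triangular book: `n` triangles sharing the hub edge.
  book : Edges (2 + n)
  book = order ++ (0F , 1F) ∷ []

  ∈-order : ∀ h i → spoke h i ∈ order
  ∈-order h i = Perm.∈-resp-↭ (↭-sym order↭) (∈-spokes h i)

  all-order : {P : Fin (2 + n) × Fin (2 + n) → Set} → (∀ h i → P (spoke h i)) → All P order
  all-order f = Perm.All-resp-↭ (↭-sym order↭) (all-spokes n f)

  book-oriented : All (uncurry _<_) book
  book-oriented = All.++⁺ (all-order (λ { 0F i → s≤s z≤n ; 1F i → s≤s (s≤s z≤n) })) (s≤s z≤n ∷ [])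

  book-unique : Unique book
  book-unique = Unique.++⁺
    (PermSetoid.Unique-resp-↭ (setoid _) (↭⇒↭ₛ (↭-sym order↭)) (spokes-unique n)) ([] ∷ [])
    λ { (i , here refl) → All.lookup (all-order {P = _≢ (0F , 1F)} λ { 0F i () ; 1F i () }) i refl }

  -- The spokes form a bipartite graph and are stored hub first, so the disjunct of `Joins` tells
  -- which end is the hub.
  joins-spoke : {xs : Vec (Fin (2 + n)) k} {u v : Fin k} → Any (Joins xs (u , v)) order →
                Hub (lookup xs u) × ¬ Hub (lookup xs v) ⊎ ¬ Hub (lookup xs u) × Hub (lookup xs v)
  joins-spoke {xs = xs} {u} {v} = uncurry orient ∘ All.lookupAny
    (all-order {P = λ (x , y) → Hub x × ¬ Hub y} λ { 0F i → hub₀ , (λ ()) ; 1F i → hub₁ , (λ ()) })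
    where
    orient : ∀ {e} → Hub (proj₁ e) × ¬ Hub (proj₂ e) → Joins xs (u , v) e →
             Hub (lookup xs u) × ¬ Hub (lookup xs v) ⊎ ¬ Hub (lookup xs u) × Hub (lookup xs v)
    orient ends       (inj₁ refl) = inj₁ ends
    orient (hub , ¬h) (inj₂ refl) = inj₂ (¬h , hub)

  -- Leaves are pairwise nonadjacent: a spoke has one hub, and the last edge has only hubs.
  opposite-hub : {xs : Vec (Fin (2 + n)) k} {u v : Fin k} →
                 Any (Joins xs (u , v)) book → ¬ Hub (lookup xs u) → Hub (lookup xs v)
  opposite-hub {xs = xs} i ¬u with ++⁻ order i
  ... | inj₁ j with joins-spoke {xs = xs} j
  ...   | inj₁ (u , _) = contradiction u ¬u
  ...   | inj₂ (_ , v) = v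
  opposite-hub {xs = xs} i ¬u | inj₂ (here (inj₁ eq)) = subst Hub (sym (cong proj₂ eq)) hub₁
  opposite-hub {xs = xs} i ¬u | inj₂ (here (inj₂ eq)) = subst Hub (sym (cong proj₁ eq)) hub₀

  -- The hub edge comes last, so it is not the first edge ab of a diamond.
  -- Hence a or b is a leaf, and the other one, v and w are three hubs.
  book-free : ¬ Embeds diamond book
  book-free (xs , inj , τ) with joins-spoke {xs = xs} (head-before-last order τ av)
  ... | inj₁ (a , ¬b) = no-three-hubs {xs = xs} inj {0F} {2F} {3F} (λ ()) (λ ()) (λ ()) a
          (opposite-hub {xs = xs} (locate τ (there bv)) ¬b) (opposite-hub {xs = xs} (locate τ (there bw)) ¬b)
  ... | inj₂ (¬a , b) = no-three-hubs {xs = xs} inj {1F} {2F} {3F} (λ ()) (λ ()) (λ ()) b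
          (opposite-hub {xs = xs} (locate τ (there av)) ¬a) (opposite-hub {xs = xs} (locate τ (there aw)) ¬a)

  -- Pairs containing a hub are present already. A missing edge joins two leaves and becomes ab,
  -- with the hubs as v and w; `leaves` supplies the rim.
  book-saturate : ∀ u v → u < v → (u , v) ∉ book → Embeds diamond ((u , v) ∷ book)
  book-saturate 0F 1F _ uv∉ = contradiction (∈-++⁺ʳ order (here refl)) uv∉
  book-saturate 0F (suc (suc j)) _ uv∉ = contradiction (∈-++⁺ˡ (∈-order 0F j)) uv∉
  book-saturate 1F 1F (s≤s ()) _
  book-saturate 1F (suc (suc j)) _ uv∉ = contradiction (∈-++⁺ˡ (∈-order 1F j)) uv∉
  book-saturate (suc (suc i)) 1F (s≤s ()) _
  book-saturate (suc (suc i)) (suc (suc j)) (s≤s (s≤s i<j)) _ =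
    leafPair i j , leafPair-injective i≢j , inj₁ refl ∷ Sublist.++ʳ _ (leaves i<j)
    where
    i≢j : i ≢ j
    i≢j refl = ℕ.<-irrefl refl i<j

  book-saturated : SaturatedEdges diamond book
  book-saturated = saturatedEdges book-free book-saturate

  length-book : length book ≤ 2 * (2 + n)
  length-book = begin
    length book                ≡⟨ length-++ order ⟩
    length order + 1           ≡⟨ cong (_+ 1) (trans (Perm.↭-length order↭) (length-spokes n)) ⟩
    -- The exact count 2n + 1 is rounded up to twice the number of vertices.
    n + n + 1                  ≤⟨ ℕ.+-monoʳ-≤ (n + n) (s≤s z≤n) ⟩
    n + n + 4                  ≡⟨ solve 1 (λ n → n :+ n :+ con 4 := con 2 :* (con 2 :+ n)) refl n ⟩
    2 * (2 + n)                ∎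
    where
    open ℕ.≤-Reasoning
    open +-*-Solver

-- Linear bounds on the saturation number

-- On at most one vertex no edge can be added, so saturation is vacuous. This makes the saturation
-- number defined for every `n`.
no-edges-saturated : {ps : Edges k} {e : Fin k × Fin k} → n ≤ 1 → SaturatedEdges {n = n} (e ∷ ps) []
no-edges-saturated n≤1 = saturatedEdges (λ { (_ , _ , ()) }) (λ u v u<v → contradiction u<v (unordered n≤1 u v))
  where
  unordered : ∀ {n} → n ≤ 1 → (u v : Fin n) → ¬ u < v
  unordered (s≤s z≤n) zero zero ()

linear : (G : EdgeOrderedGraph 4) {rim : Edges 4} → edges G ≡ (0F , 1F) ∷ rim → Rim rim →
         (∀ n → SpokeOrder rim n) →
         Σ[ sat ∈ (ℕ → ℕ) ] (∀ n → IsSatₘ n G (sat n)) × (sat =Θ (λ n → n))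
linear G {rim} refl sides O =
  -- Both constants are 2: an edge covers two vertices, and the book has fewer than twice as many
  -- edges as vertices. The threshold 2 makes room for the hubs.
  (λ n → proj₁ (sat n)) , (λ n → proj₂ (sat n)) , 2 , 2 , 2 , s≤s z≤n , s≤s z≤n , bounds
  where
  bookGraph : ∀ n → EdgeOrderedGraph (2 + n)
  bookGraph n = mkGraph book book-oriented book-unique
    where open Book sides (O n)

  bookGraph-saturated : ∀ n → Saturatedₘ G (bookGraph n)
  bookGraph-saturated n = edges⇒saturated (Book.book-saturated sides (O n))

  saturated : ∀ n → ∃ (HasSaturated G n)
  saturated 0 = _ , mkGraph [] [] [] , edges⇒saturated (no-edges-saturated z≤n) , refl
  saturated 1 = _ , mkGraph [] [] [] , edges⇒saturated (no-edges-saturated (s≤s z≤n)) , refl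
  saturated (suc (suc n)) = _ , bookGraph n , bookGraph-saturated n , refl

  sat : ∀ n → ∃ (IsSatₘ n G)
  sat n = isSat (saturated n)

  isSat⇒bounds : ∀ {n s} → IsSatₘ (2 + n) G s → 2 + n ≤ 2 * s × s ≤ 2 * (2 + n)
  isSat⇒bounds {n} isSatₘ with H , S , refl ← IsSatₘ.attained isSatₘ =
    order≤2*size sides (saturated⇒edges S) ,
    ℕ.≤-trans (IsSatₘ.minimal isSatₘ (bookGraph n) (bookGraph-saturated n)) (Book.length-book sides (O n))

  bounds : ∀ n → n ℕ.≥ 2 → n ≤ 2 * proj₁ (sat n) × proj₁ (sat n) ≤ 2 * n
  bounds (suc zero) (s≤s ())
  bounds (suc (suc n)) _ = isSat⇒bounds (proj₂ (sat (2 + n)))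

-- Spoke orders for D₃, D₄ and D₅

-- Splits the check of `leaves`: the rim is matched with four explicit spokes, and these form a
-- plain sublist of the order.
reorient : (xs : Vec (Fin n) k) {ps : Edges k} {fs es : Edges n} →
           Sublist (Joins xs) ps fs → fs ⊆ es → Sublist (Joins xs) ps es
reorient _ = Sublist.trans λ { r refl → r }

rim₃ rim₄ rim₅ : Edges 4
rim₃ = (0F , 2F) ∷ (0F , 3F) ∷ (1F , 2F) ∷ (1F , 3F) ∷ []
rim₄ = (0F , 2F) ∷ (1F , 2F) ∷ (0F , 3F) ∷ (1F , 3F) ∷ []
rim₅ = (0F , 2F) ∷ (1F , 2F) ∷ (1F , 3F) ∷ (0F , 3F) ∷ []

pair⊆allFin : {i j : Fin n} → i < j → i ∷ j ∷ [] ⊆ allFin n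
pair⊆allFin = pair⊆tabulate id

pairs : List (Fin n) → Edges (2 + n)
pairs []       = []
pairs (i ∷ is) = spoke 0F i ∷ spoke 1F i ∷ pairs is

pairs⁺ : {is js : List (Fin n)} → is ⊆ js → pairs is ⊆ pairs js
pairs⁺ []         = []
pairs⁺ (_ ∷ʳ τ)   = _ ∷ʳ _ ∷ʳ pairs⁺ τ
pairs⁺ (refl ∷ τ) = refl ∷ refl ∷ pairs⁺ τ

pairs↭ : (is : List (Fin n)) → pairs is ↭ map (spoke 0F) is ++ map (spoke 1F) is
pairs↭ []       = ↭-refl
-- `shift` moves the spoke of `i` at the second hub past the remaining spokes at the first.
pairs↭ (i ∷ is) = prep _ (↭-trans (prep _ (pairs↭ is)) (↭-sym (Perm.shift _ (map (spoke 0F) is) _)))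

spokeOrder₃ : ∀ n → SpokeOrder rim₃ n
spokeOrder₃ n = record
  { order  = pairs (allFin n)
  ; order↭ = pairs↭ (allFin n)
  ; leaves = λ {i} {j} i<j → reorient (leafPair i j)
      -- Rim edges run from leaf to hub, spokes from hub to leaf, so every match is reversed.
      (inj₂ refl ∷ inj₂ refl ∷ inj₂ refl ∷ inj₂ refl ∷ [])
      (pairs⁺ (pair⊆allFin i<j))
  }

spokeOrder₄ : ∀ n → SpokeOrder rim₄ n
spokeOrder₄ n = record
  { order  = spokes n
  ; order↭ = ↭-refl
  ; leaves = λ {i} {j} i<j → reorient (leafPair i j)
      (inj₂ refl ∷ inj₂ refl ∷ inj₂ refl ∷ inj₂ refl ∷ [])
      (⊆.++⁺ (⊆.map⁺ (spoke 0F) (pair⊆allFin i<j)) (⊆.map⁺ (spoke 1F) (pair⊆allFin i<j)))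
  }

spokeOrder₅ : ∀ n → SpokeOrder rim₅ n
spokeOrder₅ n = record
  { order  = map (spoke 0F) (allFin n) ++ map (spoke 1F) (reverse (allFin n))
  ; order↭ = Perm.++⁺ˡ (map (spoke 0F) (allFin n)) (Perm.map⁺ (spoke 1F) (Perm.↭-reverse (allFin n)))
  ; leaves = λ {i} {j} i<j → reorient (leafPair i j)
      (inj₂ refl ∷ inj₂ refl ∷ inj₂ refl ∷ inj₂ refl ∷ [])
      (⊆.++⁺ (⊆.map⁺ (spoke 0F) (pair⊆allFin i<j))
             -- Reversal puts `j` before `i` at the second hub, as bw precedes aw in `rim₅`.
             (⊆.map⁺ (spoke 1F) (⊆.reverse⁺ (pair⊆allFin i<j))))
  }

rim₃-isRim : Rim rim₃
rim₃-isRim = isRim (here refl) (there (here refl)) (there (there (here refl)))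
                   (there (there (there (here refl))))

rim₄-isRim : Rim rim₄
rim₄-isRim = isRim (here refl) (there (there (here refl))) (there (here refl))
                   (there (there (there (here refl))))

rim₅-isRim : Rim rim₅
rim₅-isRim = isRim (here refl) (there (there (there (here refl)))) (there (here refl))
                   (there (there (here refl)))

claim26 : (D : EdgeOrderedGraph 4) → D ≡ D₃ ⊎ D ≡ D₄ ⊎ D ≡ D₅ →
    Σ[ sat ∈ (ℕ → ℕ) ] (∀ n → IsSatₘ n D (sat n)) × (sat =Θ (λ n → n))
claim26 D (inj₁ refl)        = linear D refl rim₃-isRim spokeOrder₃
claim26 D (inj₂ (inj₁ refl)) = linear D refl rim₄-isRim spokeOrder₄
claim26 D (inj₂ (inj₂ refl)) = linear D refl rim₅-isRim spokeOrder₅
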